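{- Let $m\ge1$, let $B$ and $B'$ be $m$-level rook equivalent singleton boards, let $N$ be such that both $B$ and $B'$ fit inside $\Delta_{N,m}$, and let $0\le k<N$. Let $g:T\to T'$ be the Garsia–Milne bijection from $m$-level rook placements of $k$ rooks on $B$ to $m$-level rook placements of $k$ rooks on $B'$ described in the context. Then $g$ preserves the $m$-inversion number: for every $m$-level rook placement $\pi$ of $k$ rooks on $B$, $\mathrm{inv}_m(\pi)=\mathrm{inv}_m(g(\pi))$, where $\mathrm{inv}_m(\pi)$ is computed relative to $B$ and $\mathrm{inv}_m(g(\pi))$ relative to $B'$.
   Context: Fix an integer $m\ge 1$. A Ferrers board with columns of heights $0\le b_1\le\dots\le b_n$ consists of bottom-justified columns of these heights, left to right; boards differing only by empty columns on the left are identified. Level $p$ ($p\ge1$) consists of rows $(p-1)m+1,\dots,pm$, counted from the bottom. An $m$-level rook placement of $k$ rooks on $B$ is a set of $k$ cells of $B$, no two in the same column or the same level; $r_{k,m}(B)$ is the number of these; $B,B'$ are $m$-level rook equivalent if $r_{k,m}(B)=r_{k,m}(B')$ for all $k$. A column terminates in level $p$ if $p$ is the largest level it meets; $B$ is a singleton board if it is a Ferrers board and for each $p$ at most one column terminating in level $p$ has height not divisible by $m$. For an $m$-level rook placement $\pi$ on $B$, $\mathrm{inv}_m(\pi)$ is the number of cells $c$ of $B$ such that $c$ contains no rook, there is no rook above $c$ in the same column, and there is no rook to the left of $c$ in the same level. $\Delta_{n,m}$ is the Ferrers board $(0,m,2m,\dots,(n-1)m)$. $B$ fits inside $\Delta_{N,m}$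 if, on aligning lower right cells, $B$ is a subset of $\Delta_{N,m}$; then pad $B$ on the left with empty columns so $B=(b_0,\dots,b_{N-1})$ with $b_j\le jm$. If $B,B'$ are $m$-level rook equivalent singleton boards fitting inside $\Delta_{N,m}$, the sequences $(jm-b_j)_{0\le j<N}$ and $(jm-b'_j)_{0\le j<N}$ are rearrangements of each other (Briggs–Remmel). The set $S$. For $0\le i\le k$, a configuration $C\in S$ with $i$ white rooks consists of: $i$ white rooks in cells of $\Delta_{N,m}\setminus B$, no two in the same column; and $k-i$ black rooks forming an $m$-level rook placement on the inset board $\Delta_{N-i,m}$, which is formed from the $N-i$ columns of $\Delta_{N,m}$ containing no white rook by taking the bottom $jm$ cells of the $j$-th such column from the left ($j=0,1,\dots,N-i-1$). Black rooks may lie inside or outside $B$. The sign of $C$ is $(-1)^i$. The involution $I$. If all rooks of $C$ are in $B$ (hence black), $I(C)=C$; $T$ is the set of such $C$, identified with the set of $m$-level rook placements of $k$ rooks on $B$. Otherwise take the leftmost column with a rook outside $B$. If that rook is black, change it to white and move every black rook to its right in a higher level down $m$ cells. If it is white, change it to black and move every black rook to its right that is in the same or a higher level up $m$ cells. $(S',T',I')$ is defined in the same way from $B'$. The bijection $f:S\to S'$. For each length $d$, pair the columns of $\Delta_{N,m}\setminus B$ having exactly $d$ cells, from left to right, with the columns of $\Delta_{N,m}\setminus B'$ having exactly $d$ cells. A white rook in the $j$-th cell above $B$ in a column is sent to the $j$-th cell above $B'$ in the paired column. The black rooks are placed on the inset board $\Delta_{N-i,m}$ of the new configuration in the same positions,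 relative to the inset board, as they have in $C$. The bijection $g$. $g$ sends $t\in T$ to the first element of the sequence $x_0=f(t)$, $x_{j+1}=(f\circ I\circ f^{ -1}\circ I')(x_j)$ that lies in $T'$; this is a bijection $T\to T'$. -}

module Defs where

open import Data.Bool using (if_then_else_)
open import Data.List using (List; []; _∷_; _++_; map; length; filter; upTo; applyUpTo; replicate; catMaybes; cartesianProductWith; zip; zipWith)
open import Data.List.Relation.Binary.Pointwise using (Pointwise)
import Data.List.Relation.Binary.Pointwise.Properties as Pointwise
open import Data.List.Relation.Unary.All as All using (All)
open import Data.List.Relation.Unary.AllPairs using (AllPairs)
open import Data.List.Relation.Unary.Linked using (Linked)
open import Data.List.Relation.Unary.Unique.Propositional using (Unique)
open import Data.Maybe using (Maybe; just; nothing)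
import Data.Maybe.Relation.Unary.All as Maybe
open import Data.Nat using (ℕ; suc; _+_; _*_; _∸_; _≤_; _<_; _≟_; _≤?_; _<?_; NonZero)
open import Data.Nat.DivMod using (_/_)
open import Data.Nat.Divisibility using (_∣_)
open import Data.List.Relation.Unary.Unique.DecPropositional _≟_ using (unique?)
open import Data.Product using (Σ; _×_; _,_; ∃; proj₁)
open import Data.Unit using (⊤)
open import Relation.Binary.PropositionalEquality using (_≡_; _≢_)
open import Relation.Nullary using (¬_; Dec; ¬?; ⌊_⌋; _×-dec_)

-- Column heights, left to right.
Board : Set
Board = List ℕ

Ferrers : Board → Set
Ferrers = Linked _≤_

-- Rows and levels are numbered from 0: a column of height h consists of the
-- rows r < h, and row r lies in level r / m.  (With both numbered from 1, this
-- is the convention that level p consists of the rows (p-1)m+1, …, pm.)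

module _ (m : ℕ) .{{_ : NonZero m}} where

  Meets : (h p : ℕ) → Set
  Meets h p = ∃ λ r → r < h × r / m ≡ p

  TerminatesIn : (h p : ℕ) → Set
  TerminatesIn h p = Meets h p × (∀ q → Meets h q → q ≤ p)

  SingletonBoard : Board → Set
  SingletonBoard B = Ferrers B × (∀ p → AllPairs (λ h h′ → ¬ (Exceptional p h × Exceptional p h′)) B)
    where
    Exceptional : (p h : ℕ) → Set
    Exceptional p h = TerminatesIn h p × ¬ (m ∣ h)

-- Sets of cells with no two cells in the same column: the c-th entry is the row
-- of the rook in column c, if there is one.
Rooks : Set
Rooks = List (Maybe ℕ)

OnBoard : Rooks → Board → Set
OnBoard = Pointwise (λ x h → Maybe.All (_< h) x)

module _ (m : ℕ) .{{_ : NonZero m}} where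

  IsPlacement : (k : ℕ) → Board → Rooks → Set
  IsPlacement k B π = OnBoard π B
                    × Unique (map (_/ m) (catMaybes π))
                    × length (catMaybes π) ≡ k

  isPlacement? : ∀ k B π → Dec (IsPlacement k B π)
  isPlacement? k B π = Pointwise.decidable (λ x h → Maybe.dec (_<? h) x) π B
                 ×-dec unique? (map (_/ m) (catMaybes π))
                 ×-dec length (catMaybes π) ≟ k

  Placement : (k : ℕ) → Board → Set
  Placement k B = Σ Rooks (IsPlacement k B)

-- All π with OnBoard π B, each listed once.
allRooks : Board → List Rooks
allRooks []      = [] ∷ []
allRooks (h ∷ B) = cartesianProductWith _∷_ (nothing ∷ map just (upTo h)) (allRooks B)

module _ (m : ℕ) .{{_ : NonZero m}} where

  rookNumber : (k : ℕ) → Board → ℕ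
  rookNumber k B = length (filter (isPlacement? m k B) (allRooks B))

  RookEquivalent : Board → Board → Set
  RookEquivalent B B′ = ∀ k → rookNumber k B ≡ rookNumber k B′

  -- Whether the cell in row r counts towards the m-inversion number, where x is
  -- the content of its column and left lists the rows of the rooks in all
  -- columns to its left.
  Counted : (left : List ℕ) (x : Maybe ℕ) (r : ℕ) → Set
  Counted left x r = Maybe.All (λ s → s ≢ r) x
                   × Maybe.All (λ s → ¬ (r < s)) x
                   × All (λ s → s / m ≢ r / m) left

  counted? : ∀ left x r → Dec (Counted left x r)
  counted? left x r = Maybe.dec (λ s → ¬? (s ≟ r)) x
                ×-dec Maybe.dec (λ s → ¬? (r <? s)) x
                ×-dec All.all? (λ s → ¬? (s / m ≟ r / m)) left

  invFrom : (left : List ℕ) → Board → Rooks → ℕ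
  invFrom left (h ∷ B) (x ∷ π) = length (filter (counted? left x) (upTo h))
                               + invFrom (left ++ catMaybes (x ∷ [])) B π
  invFrom left _       _       = 0

  inv : Board → Rooks → ℕ
  inv = invFrom []

Δ : (m n : ℕ) → Board
Δ m n = applyUpTo (_* m) n

-- Boards differing only by empty columns on the left are identified; pad N B is
-- the representative with N columns (for boards with at most N columns).
pad : ℕ → Board → Board
pad N B = replicate (N ∸ length B) 0 ++ B

Fits : (m N : ℕ) → Board → Set
Fits m N B = Pointwise _≤_ (pad N B) (Δ m N)

-- The content of a column in a configuration: at most one rook, with its row.
-- Having one entry per column encodes that no two white rooks share a column and
-- that black rooks only stand in columns without a white rook.
data Entry : Set where
  empty : Entry
  white : ℕ → Entry
  black : ℕ → Entry

Config : Set
Config = List Entry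

#white : Config → ℕ
#white []            = 0
#white (white _ ∷ C) = suc (#white C)
#white (_       ∷ C) = #white C

toEntry : Maybe ℕ → Entry
toEntry nothing  = empty
toEntry (just r) = black r

-- The black rooks relative to the inset board, whose columns are those without a
-- white rook.  Rows are unchanged, since the inset board consists of bottom cells.
inset : Config → Rooks
inset []            = []
inset (empty   ∷ C) = nothing ∷ inset C
inset (white _ ∷ C) = inset C
inset (black r ∷ C) = just r ∷ inset C

WhiteBetween : Entry → ℕ × ℕ → Set
WhiteBetween (white r) (b , d) = b ≤ r × r < d
WhiteBetween _         _       = ⊤

Inside : Entry → ℕ → Set
Inside empty     b = ⊤
Inside (white r) b = r < b
Inside (black r) b = r < b

-- In the rest of the file a board B standing for a subset of Δ m N is padded,
-- that is, it has N columns.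

module _ (m : ℕ) .{{_ : NonZero m}} where

  record InS (N k : ℕ) (B : Board) (C : Config) : Set where
    field
      whiteCount : #white C ≤ k
      whites     : Pointwise WhiteBetween C (zip B (Δ m N))
      blacks     : IsPlacement m (k ∸ #white C) (Δ m (N ∸ #white C)) (inset C)

  InT : (N k : ℕ) (B : Board) (C : Config) → Set
  InT N k B C = InS N k B C × Pointwise Inside C B

  lower raise : (p : ℕ) → Entry → Entry
  lower p (black s) = if ⌊ p <? s / m ⌋ then black (s ∸ m) else black s
  lower p e         = e
  raise p (black s) = if ⌊ p ≤? s / m ⌋ then black (s + m) else black s
  raise p e         = e

  -- The scan from the left stops at the first rook outside B; white rooks are
  -- always outside B.  If there is no such rook, the result is C itself.
  I : Board → Config → Config
  I (b ∷ B) (empty   ∷ C) = empty ∷ I B C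
  I (b ∷ B) (white r ∷ C) = black r ∷ map (raise (r / m)) C
  I (b ∷ B) (black r ∷ C) = if ⌊ r <? b ⌋ then black r ∷ I B C
                                          else white r ∷ map (lower (r / m)) C
  I _       C             = C

-- For each column, the position above B of its white rook, if any: 0 is the
-- lowest cell outside B.
offsets : Board → Config → List (Maybe ℕ)
offsets (b ∷ B) (white r ∷ C) = just (r ∸ b) ∷ offsets B C
offsets (b ∷ B) (_       ∷ C) = nothing ∷ offsets B C
offsets _       _             = []

-- The content of the leftmost remaining column of length d, and the other columns.
extract : ℕ → List (ℕ × Maybe ℕ) → Maybe ℕ × List (ℕ × Maybe ℕ)
extract d []              = nothing , []
extract d ((d₀ , w) ∷ ws) = if ⌊ d₀ ≟ d ⌋ then (w , ws) else later (extract d ws)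
  where
  later : Maybe ℕ × List (ℕ × Maybe ℕ) → Maybe ℕ × List (ℕ × Maybe ℕ)
  later (w′ , ws′) = w′ , (d₀ , w) ∷ ws′

-- Given columns (length, content), the contents of columns with the lengths in
-- the first argument when columns of equal length are paired from left to right.
-- A column without a partner, which does not occur when the two sequences of
-- lengths are rearrangements of each other, is given no white rook.
rearrange : List ℕ → List (ℕ × Maybe ℕ) → List (Maybe ℕ)
rearrange []       ws = []
rearrange (d ∷ ds) ws with extract d ws
... | w , ws′ = w ∷ rearrange ds ws′

-- The configuration with white rooks at the given positions above B and with
-- the given content of its inset board.
assemble : Board → List (Maybe ℕ) → Rooks → Config
assemble (b ∷ B) (just j  ∷ ws) π       = white (b + j) ∷ assemble B ws π
assemble (b ∷ B) (nothing ∷ ws) (x ∷ π) = toEntry x ∷ assemble B ws π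
assemble (b ∷ B) (nothing ∷ ws) []      = empty ∷ assemble B ws []
assemble _       _              _       = []

-- The number of cells of Δ m N outside B, column by column.
colengths : (m N : ℕ) → Board → List ℕ
colengths m N B = zipWith _∸_ (Δ m N) B

f : (m N : ℕ) (B B′ : Board) → Config → Config
f m N B B′ C = assemble B′ (rearrange (colengths m N B′) (zip (colengths m N B) (offsets B C))) (inset C)

module _ (m : ℕ) .{{_ : NonZero m}} where

  -- FirstInT′ N k B B′ x z : z is the first element in T′ of the sequence
  -- x₀ = x, xⱼ₊₁ = (f ∘ I ∘ f⁻¹ ∘ I′)(xⱼ).  Here u = f⁻¹(I′ x).
  data FirstInT′ (N k : ℕ) (B B′ : Board) : Config → Config → Set where
    here  : ∀ {x} → InT m N k B′ x → FirstInT′ N k B B′ x x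
    there : ∀ {x u z} → InS m N k B′ x → ¬ InT m N k B′ x →
            InS m N k B u → f m N B B′ u ≡ I m B′ x →
            FirstInT′ N k B B′ (f m N B B′ (I m B u)) z →
            FirstInT′ N k B B′ x z

  -- T is identified with the set of placements on B by map toEntry, which makes
  -- all rooks black.
  IsGarsiaMilne : (N k : ℕ) (B B′ : Board) → (Placement m k B → Placement m k B′) → Set
  IsGarsiaMilne N k B B′ g = ∀ (t : Placement m k B) →
    FirstInT′ N k B B′ (f m N B B′ (map toEntry (proj₁ t))) (map toEntry (proj₁ (g t)))

{-# OPTIONS --safe #-}
module Submission where

-- Give a configuration C the weight inv_m of its black rooks on the inset board plus, for each
-- white rook, the number of cells of Δ above it.  On T the weight is inv_m + |Δ∖B|, because in a
-- singleton board no cell of Δ∖B is cancelled by a rook of B to its left.  The involution keeps the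
-- weight: the rook it recolours contributes the cells of Δ above it before and after, and the rooks
-- to its right only see an occupied level being inserted or deleted.  The map f keeps it as well,
-- provided that no white rook is lost; and none is lost since all configurations met have k rooks.
-- Finally |B| = r_1(B) = r_1(B′) = |B′|.

open import Data.List using (List; []; _∷_; _++_; _∷ʳ_; map; length; filter; upTo; catMaybes; zip; zipWith; applyUpTo; replicate; cartesianProductWith)
open import Data.List.Membership.Propositional using (_∈_)
open import Data.List.Properties using (filter-++; filter-accept; filter-reject; length-++; length-map; length-upTo; length-applyUpTo; length-zipWith; length-catMaybes; upTo-∷ʳ; ++-identityʳ)
open import Data.List.Relation.Binary.Pointwise using (Pointwise; []; _∷_; Pointwise-length)
open import Data.List.Relation.Unary.All as All using (All; []; _∷_)
import Data.List.Relation.Unary.All.Properties as All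
open import Data.List.Relation.Unary.AllPairs as AllPairs using (AllPairs; []; _∷_)
import Data.List.Relation.Unary.Linked.Properties as Linked
open import Data.List.Relation.Unary.Unique.Propositional using (Unique)
open import Data.Maybe as Maybe using (Maybe; just; nothing)
open import Data.Maybe.Relation.Unary.All using (just; nothing) renaming (All to MaybeAll)
open import Data.Nat using (ℕ; zero; suc; _+_; _*_; _∸_; _≤_; _<_; _≤?_; _<?_; _≟_; NonZero; z≤n; s≤s)
open import Data.Nat.DivMod using (_/_; m<n*o⇒m/o<n; m*n/n≡m; /-monoˡ-≤; m/n*n≤m; n/n≡1; +-distrib-/-∣ʳ; m/n≢0⇒n≤m; [m∸n]/n≡m/n∸1)
open import Data.Nat.Divisibility using (_∣_; divides; ∣-refl)
open import Data.Nat.ListAction using (sum)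
open import Data.Nat.ListAction.Properties using (sum-++)
open import Data.Nat.Properties
open import Algebra.Properties.CommutativeSemigroup +-commutativeSemigroup using (x∙yz≈yx∙z; x∙yz≈y∙xz) renaming (interchange to +-interchange)
open import Data.Product using (_×_; _,_; proj₁; proj₂)
open import Function using (_⇔_; mk⇔; Equivalence; _∘_)
open import Level using (0ℓ)
open import Relation.Binary.PropositionalEquality using (_≡_; _≢_; refl; sym; trans; cong; cong₂; subst; setoid; module ≡-Reasoning)
open import Relation.Nullary using (¬_; yes; no; contradiction)
open import Relation.Unary using (Pred; Decidable)
open import Defs

open Equivalence using (to; from)

-- Counting rows in initial segments.

module _ {P : Pred ℕ 0ℓ} (P? : Decidable P) where

  count : ℕ → ℕ
  count n = length (filter P? (upTo n))

  count-∷ʳ : ∀ n → count (suc n) ≡ count n + length (filter P? (n ∷ []))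
  count-∷ʳ n = begin
    length (filter P? (upTo (suc n)))                      ≡⟨ cong (length ∘ filter P?) (upTo-∷ʳ n) ⟨
    length (filter P? (upTo n ∷ʳ n))                       ≡⟨ cong length (filter-++ P? (upTo n) (n ∷ [])) ⟩
    length (filter P? (upTo n) ++ filter P? (n ∷ []))      ≡⟨ length-++ (filter P? (upTo n)) ⟩
    count n + length (filter P? (n ∷ []))                  ∎
    where open ≡-Reasoning

  count-yes : ∀ {n} → P n → count (suc n) ≡ suc (count n)
  count-yes {n} Pn = trans (count-∷ʳ n)
    (trans (cong (λ l → count n + length l) (filter-accept P? Pn)) (+-comm (count n) 1))

  count-no : ∀ {n} → ¬ P n → count (suc n) ≡ count n
  count-no {n} ¬Pn = trans (count-∷ʳ n)
    (trans (cong (λ l → count n + length l) (filter-reject P? ¬Pn)) (+-identityʳ (count n)))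

  count-all : ∀ a n → (∀ i → i < n → P (a + i)) → count (a + n) ≡ count a + n
  count-all a zero    Ps rewrite +-identityʳ a = sym (+-identityʳ _)
  count-all a (suc n) Ps rewrite +-suc a n = begin
    count (suc (a + n)) ≡⟨ count-yes (Ps n ≤-refl) ⟩
    suc (count (a + n)) ≡⟨ cong suc (count-all a n (λ i i<n → Ps i (m<n⇒m<1+n i<n))) ⟩
    suc (count a + n)   ≡⟨ +-suc (count a) n ⟨
    count a + suc n     ∎
    where open ≡-Reasoning

  count-none : ∀ a n → (∀ i → i < n → ¬ P (a + i)) → count (a + n) ≡ count a
  count-none a zero    ¬Ps = cong count (+-identityʳ a)
  count-none a (suc n) ¬Ps rewrite +-suc a n =
    trans (count-no (¬Ps n ≤-refl)) (count-none a n (λ i i<n → ¬Ps i (m<n⇒m<1+n i<n)))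

-- The starting points `a` and `b` differ when rows above an inserted level are compared with the
-- rows `m` higher.
count-shift : ∀ {P Q : Pred ℕ 0ℓ} (P? : Decidable P) (Q? : Decidable Q) a b n →
              (∀ i → i < n → P (a + i) ⇔ Q (b + i)) →
              count P? a ≡ count Q? b → count P? (a + n) ≡ count Q? (b + n)
count-shift P? Q? a b zero    P⇔Q eq rewrite +-identityʳ a | +-identityʳ b = eq
count-shift P? Q? a b (suc n) P⇔Q eq rewrite +-suc a n | +-suc b n
  with P? (a + n) | count-shift P? Q? a b n (λ i i<n → P⇔Q i (m<n⇒m<1+n i<n)) eq
... | yes p | ih = trans (count-yes P? p) (trans (cong suc ih) (sym (count-yes Q? (to (P⇔Q n ≤-refl) p))))
... | no ¬p | ih = trans (count-no P? ¬p) (trans ih (sym (count-no Q? (¬p ∘ from (P⇔Q n ≤-refl)))))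

maybe⇔ : ∀ {A B : Set} {P : Pred A 0ℓ} {Q : Pred B 0ℓ} (g : A → B) x → (∀ s → P s ⇔ Q (g s)) →
         MaybeAll P x ⇔ MaybeAll Q (Maybe.map g x)
maybe⇔ g nothing  e = mk⇔ (λ _ → nothing) (λ _ → nothing)
maybe⇔ g (just s) e = mk⇔ (λ { (just p) → just (to (e s) p) }) (λ { (just q) → just (from (e s) q) })

-- Inserting a level into the inset board.

module _ (m : ℕ) .{{_ : NonZero m}} where

  Free : List ℕ → ℕ → Set
  Free left q = All (λ s → s / m ≢ q) left

  [n+m]/m≡1+n/m : ∀ n → (n + m) / m ≡ suc (n / m)
  [n+m]/m≡1+n/m n = trans (+-distrib-/-∣ʳ n ∣-refl) (trans (cong (n / m +_) (n/n≡1 m)) (+-comm (n / m) 1))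

  p*m≤n⇒p≤n/m : ∀ {p n} → p * m ≤ n → p ≤ n / m
  p*m≤n⇒p≤n/m {p} {n} le = subst (_≤ n / m) (m*n/n≡m p m) (/-monoˡ-≤ m le)

  p≤n/m⇒p*m≤n : ∀ {p n} → p ≤ n / m → p * m ≤ n
  p≤n/m⇒p*m≤n {p} {n} le = ≤-trans (*-monoˡ-≤ m le) (m/n*n≤m n m)

  n/m<p⇒n<p*m : ∀ {p n} → n / m < p → n < p * m
  n/m<p⇒n<p*m {p} {n} lt with n <? p * m
  ... | yes n<p*m = n<p*m
  ... | no  n≮p*m = contradiction lt (≤⇒≯ (p*m≤n⇒p≤n/m (≮⇒≥ n≮p*m)))

  -- Not at the rook and not below it means strictly above it. The merged strict comparison is the
  -- form that is tracked when rooks are raised.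
  counted⇔ : ∀ left x r → Counted m left x r ⇔ (MaybeAll (_< r) x × Free left (r / m))
  counted⇔ left nothing  r = mk⇔ (λ (_ , _ , fr) → nothing , fr) (λ (_ , fr) → nothing , nothing , fr)
  counted⇔ left (just s) r = mk⇔
    (λ { (just s≢r , just r≮s , fr) → just (≤∧≢⇒< (≮⇒≥ r≮s) s≢r) , fr })
    (λ { (just s<r , fr) → just (<⇒≢ s<r) , just (<⇒≯ s<r) , fr })

  -- The action of `raise` on the row of a black rook, so that it can be mapped over the inset
  -- board.
  raiseRow : ℕ → ℕ → ℕ
  raiseRow p s with p ≤? s / m
  ... | yes _ = s + m
  ... | no  _ = s

  -- Only rows of level at least `p` are raised, and these exceed `t` both before and after.
  raiseRow-<-low : ∀ p s {t} → t < p * m → s < t ⇔ raiseRow p s < t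
  raiseRow-<-low p s {t} t<pm with p ≤? s / m
  ... | yes le = mk⇔ (λ s<t → contradiction (<-trans s<t t<pm) (≤⇒≯ (p≤n/m⇒p*m≤n le)))
                     (λ s+m<t → ≤-<-trans (m≤m+n s m) s+m<t)
  ... | no  _  = mk⇔ (λ lt → lt) (λ lt → lt)

  -- The cell `t` moves up by one level. A rook of level at least `p` moves along with it, and a
  -- lower one is below the cell before and after.
  raiseRow-<-high : ∀ p s {t} → p * m ≤ t → s < t ⇔ raiseRow p s < t + m
  raiseRow-<-high p s {t} pm≤t with p ≤? s / m
  ... | yes le = mk⇔ (+-monoˡ-< m) (+-cancelʳ-< m s t)
  ... | no nle = mk⇔ (λ s<t → <-≤-trans s<t (m≤m+n t m))
                     (λ _ → <-≤-trans (n/m<p⇒n<p*m (≰⇒> nle)) pm≤t)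

  -- left arises from left′ by inserting a rook in a new level p, which pushes level p and all
  -- higher levels up by one; below and above say this in terms of rook-free levels.
  record Inserted (p : ℕ) (left′ left : List ℕ) : Set where
    field
      occupied : ¬ Free left p
      below    : ∀ q → q < p → Free left′ q ⇔ Free left q
      above    : ∀ q → p ≤ q → Free left′ q ⇔ Free left (suc q)

  open Inserted

  -- The start of an insertion, by the recoloured rook. The rooks to its left are all in lower
  -- levels, so none of them has to move and every level from `r / m` up is free of them.
  inserted-∷ʳ : ∀ left′ {r} → All (λ s → s / m < r / m) left′ → Inserted (r / m) left′ (left′ ++ r ∷ [])
  inserted-∷ʳ left′ lows .occupied fr = All.head (All.++⁻ʳ left′ fr) refl
  inserted-∷ʳ left′ lows .below q q<p = mk⇔ (λ fr → All.++⁺ fr ((<⇒≢ q<p ∘ sym) ∷ [])) (All.++⁻ˡ left′)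
  inserted-∷ʳ left′ lows .above q p≤q = mk⇔
    (λ _ → All.++⁺ (All.map (λ lt → <⇒≢ (<-≤-trans lt (m≤n⇒m≤1+n p≤q))) lows) (<⇒≢ (s≤s p≤q) ∷ []))
    (λ _ → All.map (λ lt → <⇒≢ (<-≤-trans lt p≤q)) lows)

  free-++⇔ : ∀ {left′ left xs′ xs q q′} → Free left′ q ⇔ Free left q′ → Free xs′ q ⇔ Free xs q′ →
             Free (left′ ++ xs′) q ⇔ Free (left ++ xs) q′
  free-++⇔ {left′} {left} e₁ e₂ = mk⇔
    (λ fr → All.++⁺ (to e₁ (All.++⁻ˡ left′ fr)) (to e₂ (All.++⁻ʳ left′ fr)))
    (λ fr → All.++⁺ (from e₁ (All.++⁻ˡ left fr)) (from e₂ (All.++⁻ʳ left fr)))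

  raiseRow-free-below : ∀ p s {q} → q < p → Free (s ∷ []) q ⇔ Free (raiseRow p s ∷ []) q
  raiseRow-free-below p s q<p with p ≤? s / m
  ... | no _   = mk⇔ (λ fr → fr) (λ fr → fr)
  ... | yes le = mk⇔ (λ _ → (λ eq → <⇒≱ q<p (≤-trans (≤-trans le (/-monoˡ-≤ m (m≤m+n s m))) (≤-reflexive eq))) ∷ [])
                     (λ _ → (λ eq → <⇒≱ q<p (≤-trans le (≤-reflexive eq))) ∷ [])

  raiseRow-free-above : ∀ p s {q} → p ≤ q → Free (s ∷ []) q ⇔ Free (raiseRow p s ∷ []) (suc q)
  raiseRow-free-above p s p≤q with p ≤? s / m
  ... | yes le = mk⇔ (λ { (ne ∷ []) → (λ eq → ne (suc-injective (trans (sym ([n+m]/m≡1+n/m s)) eq))) ∷ [] })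
                     (λ { (ne ∷ []) → (λ eq → ne (trans ([n+m]/m≡1+n/m s) (cong suc eq))) ∷ [] })
  ... | no nle = mk⇔ (λ _ → <⇒≢ (<-trans (≰⇒> nle) (s≤s p≤q)) ∷ []) (λ _ → <⇒≢ (<-≤-trans (≰⇒> nle) p≤q) ∷ [])

  -- A further black rook respects the insertion: from level `p` on it moves up together with its
  -- level, and below `p` it stays where it is.
  inserted-snoc : ∀ {p left′ left} x → Inserted p left′ left →
                  Inserted p (left′ ++ catMaybes (x ∷ [])) (left ++ catMaybes (Maybe.map (raiseRow p) x ∷ []))
  inserted-snoc {p} {left′} {left} nothing  ins rewrite ++-identityʳ left′ | ++-identityʳ left = ins
  inserted-snoc {p} {left′} {left} (just s) ins .occupied fr = occupied ins (All.++⁻ˡ left fr)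
  inserted-snoc {p} (just s) ins .below q q<p = free-++⇔ (below ins q q<p) (raiseRow-free-below p s q<p)
  inserted-snoc {p} (just s) ins .above q p≤q = free-++⇔ (above ins q p≤q) (raiseRow-free-above p s p≤q)

  counted-cong : ∀ {left′ left x′ x r′ r} → MaybeAll (_< r′) x′ ⇔ MaybeAll (_< r) x →
                 Free left′ (r′ / m) ⇔ Free left (r / m) → Counted m left′ x′ r′ ⇔ Counted m left x r
  counted-cong e₁ e₂ = mk⇔
    (λ c → let (a , fr) = to (counted⇔ _ _ _) c in from (counted⇔ _ _ _) (to e₁ a , to e₂ fr))
    (λ c → let (a , fr) = to (counted⇔ _ _ _) c in from (counted⇔ _ _ _) (from e₁ a , from e₂ fr))

  -- The rows are cut at `p * m`. Those below correspond one to one; level `p` of the taller column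
  -- counts nothing, being occupied from the left; those above correspond to rows `m` higher. By
  -- `p ≤ j` the column reaches the place of insertion.
  insert-level-count : ∀ {p left′ left j} x → Inserted p left′ left → p ≤ j →
    count (counted? m left′ x) (j * m) ≡ count (counted? m left (Maybe.map (raiseRow p) x)) (suc j * m)
  insert-level-count {p} {left′} {left} {j} x ins p≤j = begin
    count P? (j * m)               ≡⟨ cong (count P?) jm ⟩
    count P? (p * m + n)           ≡⟨ count-shift P? Q? (p * m) (p * m + m) n high (trans low (sym mid)) ⟩
    count Q? (p * m + m + n)       ≡⟨ cong (count Q?) sjm ⟨
    count Q? (suc j * m)           ∎
    where
    open ≡-Reasoning
    P? = counted? m left′ x
    Q? = counted? m left (Maybe.map (raiseRow p) x)
    n = (j ∸ p) * m
    jm : j * m ≡ p * m + n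
    jm = trans (cong (_* m) (sym (m+[n∸m]≡n p≤j))) (*-distribʳ-+ m p (j ∸ p))
    sjm : suc j * m ≡ p * m + m + n
    sjm = trans (cong (m +_) jm) (trans (sym (+-assoc m (p * m) n)) (cong (_+ n) (+-comm m (p * m))))
    low : count P? (p * m) ≡ count Q? (p * m)
    low = count-shift P? Q? 0 0 (p * m)
      (λ t t<pm → counted-cong (maybe⇔ (raiseRow p) x (λ s → raiseRow-<-low p s t<pm)) (below ins _ (m<n*o⇒m/o<n t<pm)))
      refl
    level-p : ∀ {i} → i < m → (p * m + i) / m ≡ p
    level-p {i} i<m = ≤-antisym (≤-pred (m<n*o⇒m/o<n (subst (p * m + i <_) (+-comm (p * m) m) (+-monoʳ-< (p * m) i<m))))
                                (p*m≤n⇒p≤n/m (m≤m+n (p * m) i))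
    mid : count Q? (p * m + m) ≡ count Q? (p * m)
    mid = count-none Q? (p * m) m
      (λ i i<m (_ , _ , fr) → occupied ins (subst (Free left) (level-p i<m) fr))
    shift : ∀ i → p * m + m + i ≡ p * m + i + m
    shift i = trans (+-assoc (p * m) m i) (trans (cong (p * m +_) (+-comm m i)) (sym (+-assoc (p * m) i m)))
    high : ∀ i → i < n → Counted m left′ x (p * m + i) ⇔ Counted m left (Maybe.map (raiseRow p) x) (p * m + m + i)
    high i _ rewrite shift i = counted-cong
      (maybe⇔ (raiseRow p) x (λ s → raiseRow-<-high p s (m≤m+n (p * m) i)))
      (subst (λ q → Free left′ ((p * m + i) / m) ⇔ Free left q) (sym ([n+m]/m≡1+n/m (p * m + i)))
             (above ins _ (p*m≤n⇒p≤n/m (m≤m+n (p * m) i))))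

  -- This is `inv` on the inset board from its column `j` on. Heights are read off the column index,
  -- so that a new column to the left is just a shift of `j`.
  staircaseInv : ℕ → List ℕ → Rooks → ℕ
  staircaseInv j left []      = 0
  staircaseInv j left (x ∷ π) = count (counted? m left x) (j * m) + staircaseInv (suc j) (left ++ catMaybes (x ∷ [])) π

  -- When a white rook turns black its column joins the inset board. Every later inset column then
  -- becomes taller by `m`, which is exactly the inserted level.
  staircaseInv-insert : ∀ {p j left′ left} π → Inserted p left′ left → p ≤ j →
                  staircaseInv j left′ π ≡ staircaseInv (suc j) left (map (Maybe.map (raiseRow p)) π)
  staircaseInv-insert []      ins p≤j = refl
  staircaseInv-insert (x ∷ π) ins p≤j =
    cong₂ _+_ (insert-level-count x ins p≤j) (staircaseInv-insert π (inserted-snoc x ins) (m≤n⇒m≤1+n p≤j))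

-- Singleton boards, the weight, and its invariance under the involution.

+-assoc-cong : ∀ c {t t′ w w′ : ℕ} → t + w ≡ t′ + w′ → c + t + w ≡ c + t′ + w′
+-assoc-cong c {t} {t′} {w} {w′} eq = trans (+-assoc c t w) (trans (cong (c +_) eq) (sym (+-assoc c t′ w′)))

-- For a column with `d` cells outside the board and a white rook at offset `o`, these are the cells
-- of `Δ` above the rook. Only the pair enters, and `f` transports such pairs.
cellsAbove : ℕ × Maybe ℕ → ℕ
cellsAbove (d , nothing) = 0
cellsAbove (d , just o)  = d ∸ suc o

#rooks : Config → ℕ
#rooks []            = 0
#rooks (empty   ∷ C) = #rooks C
#rooks (white _ ∷ C) = suc (#rooks C)
#rooks (black _ ∷ C) = suc (#rooks C)

#rooks-split : ∀ C → #rooks C ≡ #white C + length (catMaybes (inset C))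
#rooks-split []            = refl
#rooks-split (empty   ∷ C) = #rooks-split C
#rooks-split (white _ ∷ C) = cong suc (#rooks-split C)
#rooks-split (black _ ∷ C) = trans (cong suc (#rooks-split C)) (sym (+-suc (#white C) _))

module _ (m : ℕ) .{{_ : NonZero m}} where

  -- The columns of `Δ` from column `j` on, in a form suited to induction along the columns.
  staircase : (j n : ℕ) → Board
  staircase j zero    = []
  staircase j (suc n) = j * m ∷ staircase (suc j) n

  Δ≡staircase : ∀ n → Δ m n ≡ staircase 0 n
  Δ≡staircase n = from-column (_* m) 0 n (λ _ → refl)
    where
    from-column : ∀ h j n → (∀ i → h i ≡ (j + i) * m) → applyUpTo h n ≡ staircase j n
    from-column h j zero    eq = refl
    from-column h j (suc n) eq = cong₂ _∷_ (trans (eq 0) (cong (_* m) (+-identityʳ j)))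
      (from-column (h ∘ suc) (suc j) n (λ i → trans (eq (suc i)) (cong (_* m) (+-suc j i))))

  colengthsFrom : ℕ → Board → List ℕ
  colengthsFrom j []      = []
  colengthsFrom j (b ∷ B) = (j * m ∸ b) ∷ colengthsFrom (suc j) B

  colengths≡ : ∀ j B → zipWith _∸_ (staircase j (length B)) B ≡ colengthsFrom j B
  colengths≡ j []      = refl
  colengths≡ j (b ∷ B) = cong (_ ∷_) (colengths≡ (suc j) B)

  length-colengthsFrom : ∀ j B → length (colengthsFrom j B) ≡ length B
  length-colengthsFrom j []      = refl
  length-colengthsFrom j (b ∷ B) = cong suc (length-colengthsFrom (suc j) B)

  -- Since `suc (s / m) * m` is the height at which the level of `s` ends, a column of height `h`
  -- contains its share of that level completely.
  CoversLevels : List ℕ → ℕ → Set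
  CoversLevels rows h = All (λ s → suc (s / m) * m ≤ h) rows

  -- The only consequence of being a singleton board that matters: a rook in B leaves no cell of
  -- its level outside B in the columns to its right.
  LevelClosed : Board → Set
  LevelClosed = AllPairs (λ b b′ → ∀ r → r < b → suc (r / m) * m ≤ b′)

  -- If a later column `b′` stopped short of the top of the level of `r`, then `r < b ≤ b′` would
  -- make both columns end in that level at a height not divisible by `m`.
  singleton⇒levelClosed : ∀ {B} → SingletonBoard m B → LevelClosed B
  singleton⇒levelClosed {B} (ferrers , single) = go (Linked.Linked⇒AllPairs ≤-trans ferrers) single
    where
    terminates : ∀ {h r} → r < h → h < suc (r / m) * m → TerminatesIn m h (r / m)
    terminates {h} {r} r<h h<next = (r , r<h , refl) ,
      λ { q (t , t<h , refl) → ≤-pred (m<n*o⇒m/o<n (<-trans t<h h<next)) }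
    -- A multiple `q * m` in this range would give `r / m < q < suc (r / m)`.
    not-multiple : ∀ {h r} → r < h → h < suc (r / m) * m → ¬ (m ∣ h)
    not-multiple {h} {r} r<h h<next (divides q refl) =
      <⇒≱ (*-cancelʳ-< m q (suc (r / m)) h<next) (*-cancelʳ-< m (r / m) q (≤-<-trans (m/n*n≤m r m) r<h))
    Exceptional : ℕ → ℕ → Set
    Exceptional p h = TerminatesIn m h p × ¬ (m ∣ h)
    go : ∀ {B} → AllPairs _≤_ B → (∀ p → AllPairs (λ h h′ → ¬ (Exceptional p h × Exceptional p h′)) B) → LevelClosed B
    go []                           ex = []
    go {b ∷ B} (b≤ ∷ B-increasing) ex = All.tabulate covers ∷ go B-increasing (λ p → AllPairs.tail (ex p))
      where
      covers : ∀ {b′} → b′ ∈ B → ∀ r → r < b → suc (r / m) * m ≤ b′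
      covers {b′} b′∈B r r<b with suc (r / m) * m ≤? b′
      ... | yes le = le
      ... | no ¬le = contradiction (exceptional r<b b<next , exceptional (<-≤-trans r<b b≤b′) b′<next)
                                   (All.lookup (AllPairs.head (ex (r / m))) b′∈B)
        where
        b≤b′ = All.lookup b≤ b′∈B
        b′<next = ≰⇒> ¬le
        b<next = ≤-<-trans b≤b′ b′<next
        exceptional : ∀ {h} → r < h → h < suc (r / m) * m → Exceptional (r / m) h
        exceptional r<h h<next = terminates r<h h<next , not-multiple r<h h<next

  levelClosed-pad : ∀ n {B} → LevelClosed B → LevelClosed (replicate n 0 ++ B)
  levelClosed-pad zero    closed = closed
  levelClosed-pad (suc n) closed = All.tabulate (λ _ _ ()) ∷ levelClosed-pad n closed

  covers⇒/< : ∀ {left b t} → CoversLevels left b → b ≤ t → All (λ s → s / m < t / m) left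
  covers⇒/< covers b≤t = All.map (λ le → p*m≤n⇒p≤n/m m (≤-trans le b≤t)) covers

  covers⇒free : ∀ {left b t} → CoversLevels left b → b ≤ t → Free m left (t / m)
  covers⇒free covers b≤t = All.map <⇒≢ (covers⇒/< covers b≤t)

  covers-snoc : ∀ {left b B} x → MaybeAll (_< b) x → All (λ b′ → ∀ r → r < b → suc (r / m) * m ≤ b′) B →
                All (CoversLevels left) B → All (CoversLevels (left ++ catMaybes (x ∷ []))) B
  covers-snoc {left} nothing  _          _      covers rewrite ++-identityʳ left = covers
  covers-snoc        (just r) (just r<b) closed covers =
    All.zipWith (λ (cl , cov) → All.++⁺ cov (cl r r<b ∷ [])) (closed , covers)

  -- Every cell outside the board counts: the rook of its column is lower, being in the board, and
  -- the rooks to the left are in strictly lower levels.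
  count-outside : ∀ {left x b h} → CoversLevels left b → MaybeAll (_< b) x → b ≤ h →
                  count (counted? m left x) h ≡ count (counted? m left x) b + (h ∸ b)
  count-outside {left} {x} {b} {h} covers x<b b≤h = trans (cong (count _) (sym (m+[n∸m]≡n b≤h)))
    (count-all (counted? m left x) b (h ∸ b) (λ i _ → from (counted⇔ m left x (b + i))
      (below x<b (m≤m+n b i) , covers⇒free covers (m≤m+n b i))))
    where
    below : ∀ {x t} → MaybeAll (_< b) x → b ≤ t → MaybeAll (_< t) x
    below nothing    _   = nothing
    below (just s<b) b≤t = just (<-≤-trans s<b b≤t)

  -- Column by column, the surplus over `inv` is the part outside the board. The covering condition
  -- passes to the next column because the rook just met is in `B`.
  staircaseInv-onBoard : ∀ {j n left B π} → Pointwise _≤_ B (staircase j n) → LevelClosed B → All (CoversLevels left) B →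
                   OnBoard π B → staircaseInv m j left π ≡ invFrom m left B π + sum (colengthsFrom j B)
  staircaseInv-onBoard fits closed covers [] = refl
  staircaseInv-onBoard {j} {suc n} {left} {b ∷ B} {x ∷ π} (b≤jm ∷ fits) (closed ∷ closeds) (cover ∷ covers) (x<b ∷ on) = begin
    count (counted? m left x) (j * m) + staircaseInv m (suc j) left⁺ π
      ≡⟨ cong₂ _+_ (count-outside cover x<b b≤jm) (staircaseInv-onBoard fits closeds (covers-snoc x x<b closed covers) on) ⟩
    (count (counted? m left x) b + (j * m ∸ b)) + (invFrom m left⁺ B π + sum (colengthsFrom (suc j) B))
      ≡⟨ +-interchange (count (counted? m left x) b) (j * m ∸ b) (invFrom m left⁺ B π) _ ⟩
    (count (counted? m left x) b + invFrom m left⁺ B π) + ((j * m ∸ b) + sum (colengthsFrom (suc j) B)) ∎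
    where
    open ≡-Reasoning
    left⁺ = left ++ catMaybes (x ∷ [])

  -- One index `j` serves for the column of `Δ` and for the column of the inset board. The two agree
  -- as long as no white rook has been passed, which is so throughout the scan made by `I`.
  weightFrom : ℕ → List ℕ → Board → Config → ℕ
  weightFrom j left B C = staircaseInv m j left (inset C) + sum (map cellsAbove (zip (colengthsFrom j B) (offsets B C)))

  inset-raise : ∀ p C → inset (map (raise m p) C) ≡ map (Maybe.map (raiseRow m p)) (inset C)
  inset-raise p []            = refl
  inset-raise p (empty   ∷ C) = cong (nothing ∷_) (inset-raise p C)
  inset-raise p (white r ∷ C) = inset-raise p C
  inset-raise p (black s ∷ C) with p ≤? s / m
  ... | yes _ = cong (_ ∷_) (inset-raise p C)
  ... | no  _ = cong (_ ∷_) (inset-raise p C)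

  offsets-raise : ∀ p B C → offsets B (map (raise m p) C) ≡ offsets B C
  offsets-raise p []      C             = refl
  offsets-raise p (b ∷ B) []            = refl
  offsets-raise p (b ∷ B) (empty   ∷ C) = cong (nothing ∷_) (offsets-raise p B C)
  offsets-raise p (b ∷ B) (white r ∷ C) = cong (_ ∷_) (offsets-raise p B C)
  offsets-raise p (b ∷ B) (black s ∷ C) with p ≤? s / m
  ... | yes _ = cong (nothing ∷_) (offsets-raise p B C)
  ... | no  _ = cong (nothing ∷_) (offsets-raise p B C)

  -- Rooks that were above level `p` drop by one level, hence stay at level `p` or higher and are
  -- raised back. A rook already in level `p` would be raised without having been lowered; the
  -- hypothesis excludes it.
  raise-lower : ∀ p C → All (p ≢_) (map (_/ m) (catMaybes (inset C))) → map (raise m p) (map (lower m p) C) ≡ C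
  raise-lower p []            _         = refl
  raise-lower p (empty   ∷ C) ne        = cong (_ ∷_) (raise-lower p C ne)
  raise-lower p (white r ∷ C) ne        = cong (_ ∷_) (raise-lower p C ne)
  raise-lower p (black s ∷ C) (p≢ ∷ ne) = cong₂ _∷_ entry (raise-lower p C ne)
    where
    entry : raise m p (lower m p (black s)) ≡ black s
    entry with p <? s / m
    entry | yes p< with p ≤? (s ∸ m) / m
    ... | yes _  = cong black (m∸n+n≡m (m/n≢0⇒n≤m (m<n⇒n≢0 p<)))
    ... | no ¬p≤ = contradiction (≤-trans (<⇒≤pred p<) (≤-reflexive (sym ([m∸n]/n≡m/n∸1 s m)))) ¬p≤
    entry | no p≮ with p ≤? s / m
    ... | yes p≤ = contradiction (≤∧≢⇒< p≤ p≢) p≮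
    ... | no  _  = refl

  -- No cell up to the rook counts, and each one above it does, because the rooks to the left lie in
  -- levels below that of `r`.
  count-above : ∀ {left b r} h → CoversLevels left b → b ≤ r → r < h →
                count (counted? m left (just r)) h ≡ h ∸ suc r
  count-above {left} {b} {r} h covers b≤r r<h = begin
    count c? h
      ≡⟨ cong (count c?) (m+[n∸m]≡n r<h) ⟨
    count c? (suc r + (h ∸ suc r))
      ≡⟨ count-all c? (suc r) (h ∸ suc r) (λ i _ → from (counted⇔ m left _ _)
           (just (s≤s (m≤m+n r i)) , covers⇒free covers (≤-trans b≤r (m≤n⇒m≤1+n (m≤m+n r i))))) ⟩
    count c? (suc r) + (h ∸ suc r)
      ≡⟨ cong (_+ (h ∸ suc r)) (count-none c? 0 (suc r) λ i i≤r c → notBelow i≤r (proj₁ (to (counted⇔ m left _ _) c))) ⟩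
    h ∸ suc r ∎
    where
    open ≡-Reasoning
    c? = counted? m left (just r)
    notBelow : ∀ {i} → i < suc r → ¬ MaybeAll (_< i) (just r)
    notBelow i≤r (just r<i) = <⇒≱ r<i (≤-pred i≤r)

  -- The rook at `r` contributes `j * m ∸ suc r` in either colour. For the black rooks to its right
  -- the change of colour is the insertion of level `r / m`, and the offsets of white rooks do not
  -- change.
  weight-flip : ∀ {j left b r} B C → CoversLevels left b → b ≤ r → r < j * m →
                weightFrom j left (b ∷ B) (white r ∷ C) ≡ weightFrom j left (b ∷ B) (black r ∷ map (raise m (r / m)) C)
  weight-flip {j} {left} {b} {r} B C covers b≤r r<jm = begin
    staircaseInv m j left (inset C) + ((j * m ∸ b ∸ suc (r ∸ b)) + whites C)
      -- From `r < j * m` the inserted level `r / m` is below `j`, as the insertion requires.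
      ≡⟨ cong₂ (λ x y → x + (y + whites C)) (staircaseInv-insert m (inset C) (inserted-∷ʳ m left (covers⇒/< covers b≤r))
           (<⇒≤ (m<n*o⇒m/o<n r<jm))) cells ⟩
    staircaseInv m (suc j) left⁺ (map (Maybe.map (raiseRow m p)) (inset C)) + (count c? (j * m) + whites C)
      ≡⟨ cong₂ (λ x y → staircaseInv m (suc j) left⁺ x + (count c? (j * m) + sum (map cellsAbove (zip (colengthsFrom (suc j) B) y))))
           (inset-raise p C) (offsets-raise p B C) ⟨
    staircaseInv m (suc j) left⁺ (inset C⁺) + (count c? (j * m) + whites C⁺)
      ≡⟨ x∙yz≈yx∙z (staircaseInv m (suc j) left⁺ (inset C⁺)) (count c? (j * m)) (whites C⁺) ⟩
    count c? (j * m) + staircaseInv m (suc j) left⁺ (inset C⁺) + whites C⁺ ∎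
    where
    open ≡-Reasoning
    p = r / m
    C⁺ = map (raise m p) C
    left⁺ = left ++ r ∷ []
    c? = counted? m left (just r)
    whites : Config → ℕ
    whites D = sum (map cellsAbove (zip (colengthsFrom (suc j) B) (offsets B D)))
    cells : j * m ∸ b ∸ suc (r ∸ b) ≡ count c? (j * m)
    cells = begin
      j * m ∸ b ∸ suc (r ∸ b)     ≡⟨ ∸-+-assoc (j * m) b (suc (r ∸ b)) ⟩
      j * m ∸ (b + suc (r ∸ b))   ≡⟨ cong (j * m ∸_) (trans (+-suc b (r ∸ b)) (cong suc (m+[n∸m]≡n b≤r))) ⟩
      j * m ∸ suc r               ≡⟨ count-above (j * m) covers b≤r r<jm ⟨
      count c? (j * m)            ∎

  -- The induction follows the scan of `I`. Rooks passed are in `B`, which keeps the covering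
  -- condition for the columns to come; the first rook outside `B` is treated by `weight-flip`.
  weight-I : ∀ {j n n′ left} B C → LevelClosed B → All (CoversLevels left) B →
             Pointwise WhiteBetween C (zip B (staircase j n)) → OnBoard (inset C) (staircase j n′) →
             Unique (map (_/ m) (catMaybes (inset C))) → weightFrom j left B (I m B C) ≡ weightFrom j left B C
  weight-I []      C  _ _ _ _ _ = refl
  weight-I (b ∷ B) [] _ _ _ _ _ = refl
  weight-I {j} {suc n} {suc n′} {left} (b ∷ B) (empty ∷ C) (closed ∷ closeds) (_ ∷ covers) (_ ∷ ws) (_ ∷ on) un =
    +-assoc-cong (count _ (j * m)) (weight-I B C closeds (covers-snoc {left} {b} nothing nothing closed covers) ws on un)
  weight-I {j} {suc n} (b ∷ B) (white r ∷ C) _ (cover ∷ _) ((b≤r , r<jm) ∷ _) _ _ = sym (weight-flip B C cover b≤r r<jm)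
  weight-I {j} {suc n} {suc n′} {left} (b ∷ B) (black r ∷ C) (closed ∷ closeds) (cover ∷ covers) (_ ∷ ws) (just r<jm ∷ on) (fresh ∷ un)
    with r <? b
  ... | yes r<b = +-assoc-cong (count _ (j * m)) (weight-I B C closeds (covers-snoc (just r) (just r<b) closed covers) ws on un)
  -- Black to white is the same flip read backwards: raising the lowered rooks restores `C`, since
  -- no rook to the right shares the level of `r`.
  ... | no  r≮b = trans (weight-flip B (map (lower m (r / m)) C) cover (≮⇒≥ r≮b) r<jm)
                        (cong (λ D → weightFrom j left (b ∷ B) (black r ∷ D)) (raise-lower (r / m) C fresh))

-- Transport of white rooks by `f`.

hasRook : ℕ × Maybe ℕ → ℕ
hasRook (d , nothing) = 0
hasRook (d , just _)  = 1

module _ (φ : ℕ × Maybe ℕ → ℕ) (φ-nothing : ∀ d → φ (d , nothing) ≡ 0) where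

  -- One pair is moved to the front. If no column of length `d` remains, the default content
  -- `nothing` contributes zero.
  sum-extract : ∀ d ws → φ (d , proj₁ (extract d ws)) + sum (map φ (proj₂ (extract d ws))) ≡ sum (map φ ws)
  sum-extract d []              = trans (+-identityʳ _) (φ-nothing d)
  sum-extract d ((d₀ , w) ∷ ws) with d₀ ≟ d
  ... | yes refl = refl
  ... | no  _    = trans (x∙yz≈y∙xz (φ (d , proj₁ (extract d ws))) (φ (d₀ , w)) _) (cong (φ (d₀ , w) +_) (sum-extract d ws))

-- The columns left without a partner; a white rook dropped by `rearrange` would be found here.
unpaired : List ℕ → List (ℕ × Maybe ℕ) → List (ℕ × Maybe ℕ)
unpaired []       ws = ws
unpaired (d ∷ ds) ws = unpaired ds (proj₂ (extract d ws))

-- Used with `hasRook` to see that no rook is lost, and then with `cellsAbove` to compare weights.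
sum-rearrange : ∀ (φ : ℕ × Maybe ℕ → ℕ) → (∀ d → φ (d , nothing) ≡ 0) → ∀ ds ws →
                sum (map φ (zip ds (rearrange ds ws))) + sum (map φ (unpaired ds ws)) ≡ sum (map φ ws)
sum-rearrange φ φ-nothing []       ws = refl
sum-rearrange φ φ-nothing (d ∷ ds) ws = trans (+-assoc (φ (d , proj₁ (extract d ws))) _ _)
  (trans (cong (φ (d , proj₁ (extract d ws)) +_) (sum-rearrange φ φ-nothing ds _)) (sum-extract φ φ-nothing d ws))

cellsAbove-rookless : ∀ ws → sum (map hasRook ws) ≡ 0 → sum (map cellsAbove ws) ≡ 0
cellsAbove-rookless []                   _  = refl
cellsAbove-rookless ((d , nothing) ∷ ws) eq = cellsAbove-rookless ws eq

length-rearrange : ∀ ds ws → length (rearrange ds ws) ≡ length ds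
length-rearrange []       ws = refl
length-rearrange (d ∷ ds) ws = cong suc (length-rearrange ds _)

sum-hasRook : ∀ ds ws → length ds ≡ length ws → sum (map hasRook (zip ds ws)) ≡ length (catMaybes ws)
sum-hasRook []       []             _  = refl
sum-hasRook (d ∷ ds) (nothing ∷ ws) eq = sum-hasRook ds ws (suc-injective eq)
sum-hasRook (d ∷ ds) (just _  ∷ ws) eq = cong suc (sum-hasRook ds ws (suc-injective eq))

length-offsets : ∀ B C → length C ≡ length B → length (offsets B C) ≡ length B
length-offsets []      []            _  = refl
length-offsets (b ∷ B) (empty   ∷ C) eq = cong suc (length-offsets B C (suc-injective eq))
length-offsets (b ∷ B) (white _ ∷ C) eq = cong suc (length-offsets B C (suc-injective eq))
length-offsets (b ∷ B) (black _ ∷ C) eq = cong suc (length-offsets B C (suc-injective eq))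

#white-offsets : ∀ B C → length C ≡ length B → length (catMaybes (offsets B C)) ≡ #white C
#white-offsets []      []            _  = refl
#white-offsets (b ∷ B) (empty   ∷ C) eq = #white-offsets B C (suc-injective eq)
#white-offsets (b ∷ B) (white _ ∷ C) eq = cong suc (#white-offsets B C (suc-injective eq))
#white-offsets (b ∷ B) (black _ ∷ C) eq = #white-offsets B C (suc-injective eq)

#white+inset : ∀ C → #white C + length (inset C) ≡ length C
#white+inset []            = refl
#white+inset (empty   ∷ C) = trans (+-suc (#white C) _) (cong suc (#white+inset C))
#white+inset (white _ ∷ C) = cong suc (#white+inset C)
#white+inset (black _ ∷ C) = trans (+-suc (#white C) _) (cong suc (#white+inset C))

-- Rooks may be dropped when the board runs out, but none is created. Knowing the rooks of the
-- result thus bounds the white rooks in `ws` from below.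
#rooks-assemble : ∀ B ws π → #rooks (assemble B ws π) ≤ length (catMaybes ws) + length (catMaybes π)
#rooks-assemble []      ws             π             = z≤n
#rooks-assemble (b ∷ B) []             π             = z≤n
#rooks-assemble (b ∷ B) (just j  ∷ ws) π             = s≤s (#rooks-assemble B ws π)
#rooks-assemble (b ∷ B) (nothing ∷ ws) []            = #rooks-assemble B ws []
#rooks-assemble (b ∷ B) (nothing ∷ ws) (nothing ∷ π) = #rooks-assemble B ws π
#rooks-assemble (b ∷ B) (nothing ∷ ws) (just x  ∷ π) =
  ≤-trans (s≤s (#rooks-assemble B ws π)) (≤-reflexive (sym (+-suc (length (catMaybes ws)) _)))

-- The second equation says that the columns without a white rook are exactly as many as the entries
-- of `π`, so nothing is padded or cut off.
inset-assemble : ∀ B ws π → length ws ≡ length B → length (catMaybes ws) + length π ≡ length B →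
                 inset (assemble B ws π) ≡ π
inset-assemble []      []             []            _  _   = refl
inset-assemble (b ∷ B) (just j  ∷ ws) π             eq eq′ = inset-assemble B ws π (suc-injective eq) (suc-injective eq′)
-- With `π` used up, every remaining column would have to hold a white rook, and this one does not.
inset-assemble (b ∷ B) (nothing ∷ ws) []            eq eq′ =
  contradiction (trans (sym (+-identityʳ _)) (trans eq′ (sym eq))) (<⇒≢ (s≤s (length-catMaybes ws)))
inset-assemble (b ∷ B) (nothing ∷ ws) (nothing ∷ π) eq eq′ =
  cong (nothing ∷_) (inset-assemble B ws π (suc-injective eq) (suc-injective (trans (sym (+-suc _ _)) eq′)))
inset-assemble (b ∷ B) (nothing ∷ ws) (just r  ∷ π) eq eq′ =
  cong (just r ∷_) (inset-assemble B ws π (suc-injective eq) (suc-injective (trans (sym (+-suc _ _)) eq′)))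

offsets-assemble : ∀ B ws π → length ws ≡ length B → offsets B (assemble B ws π) ≡ ws
offsets-assemble []      []             π             _  = refl
offsets-assemble (b ∷ B) (just j  ∷ ws) π             eq = cong₂ _∷_ (cong just (m+n∸m≡n b j)) (offsets-assemble B ws π (suc-injective eq))
offsets-assemble (b ∷ B) (nothing ∷ ws) []            eq = cong (nothing ∷_) (offsets-assemble B ws [] (suc-injective eq))
offsets-assemble (b ∷ B) (nothing ∷ ws) (nothing ∷ π) eq = cong (nothing ∷_) (offsets-assemble B ws π (suc-injective eq))
offsets-assemble (b ∷ B) (nothing ∷ ws) (just r  ∷ π) eq = cong (nothing ∷_) (offsets-assemble B ws π (suc-injective eq))

#rooks-map : ∀ (h : Entry → Entry) → (∀ e C → #rooks (h e ∷ C) ≡ #rooks (e ∷ C)) → ∀ C → #rooks (map h C) ≡ #rooks C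
#rooks-map h same []            = refl
#rooks-map h same (empty   ∷ C) = trans (same empty _) (#rooks-map h same C)
#rooks-map h same (white r ∷ C) = trans (same (white r) _) (cong suc (#rooks-map h same C))
#rooks-map h same (black r ∷ C) = trans (same (black r) _) (cong suc (#rooks-map h same C))

inset-toEntry : ∀ π → inset (map toEntry π) ≡ π
inset-toEntry []            = refl
inset-toEntry (nothing ∷ π) = cong (nothing ∷_) (inset-toEntry π)
inset-toEntry (just r  ∷ π) = cong (just r ∷_) (inset-toEntry π)

#white-toEntry : ∀ π → #white (map toEntry π) ≡ 0
#white-toEntry []            = refl
#white-toEntry (nothing ∷ π) = #white-toEntry π
#white-toEntry (just r  ∷ π) = #white-toEntry π

-- The weight along the Garsia-Milne sequence.

module _ (m : ℕ) .{{_ : NonZero m}} where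

  #rooks-raise : ∀ p C → #rooks (map (raise m p) C) ≡ #rooks C
  #rooks-raise p = #rooks-map (raise m p) same
    where
    same : ∀ e C → #rooks (raise m p e ∷ C) ≡ #rooks (e ∷ C)
    same empty     C = refl
    same (white r) C = refl
    same (black s) C with p ≤? s / m
    ... | yes _ = refl
    ... | no  _ = refl

  #rooks-lower : ∀ p C → #rooks (map (lower m p) C) ≡ #rooks C
  #rooks-lower p = #rooks-map (lower m p) same
    where
    same : ∀ e C → #rooks (lower m p e ∷ C) ≡ #rooks (e ∷ C)
    same empty     C = refl
    same (white r) C = refl
    same (black s) C with p <? s / m
    ... | yes _ = refl
    ... | no  _ = refl

  #rooks-I : ∀ B C → #rooks (I m B C) ≡ #rooks C
  #rooks-I []      C             = refl
  #rooks-I (b ∷ B) []            = refl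
  #rooks-I (b ∷ B) (empty   ∷ C) = #rooks-I B C
  #rooks-I (b ∷ B) (white r ∷ C) = cong suc (#rooks-raise (r / m) C)
  #rooks-I (b ∷ B) (black r ∷ C) with r <? b
  ... | yes _ = cong suc (#rooks-I B C)
  ... | no  _ = cong suc (#rooks-lower (r / m) C)

  length-I : ∀ B C → length (I m B C) ≡ length C
  length-I []      C             = refl
  length-I (b ∷ B) []            = refl
  length-I (b ∷ B) (empty   ∷ C) = cong suc (length-I B C)
  length-I (b ∷ B) (white r ∷ C) = cong suc (length-map _ C)
  length-I (b ∷ B) (black r ∷ C) with r <? b
  ... | yes _ = cong suc (length-I B C)
  ... | no  _ = cong suc (length-map _ C)

  weight : Board → Config → ℕ
  weight = weightFrom m 0 []

  colengths≡colengthsFrom : ∀ {N} B → length B ≡ N → colengths m N B ≡ colengthsFrom m 0 B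
  colengths≡colengthsFrom B refl = trans (cong (λ D → zipWith _∸_ D B) (Δ≡staircase m (length B))) (colengths≡ m 0 B)

  -- The weight depends only on the inset board, which `f` copies, and on the pairs of column length
  -- and offset, which `f` permutes. The equal rook counts ensure that no pair with a rook is left
  -- unpaired.
  weight-f : ∀ {N} B B′ C → length B ≡ N → length B′ ≡ N → length C ≡ N →
             #rooks (f m N B B′ C) ≡ #rooks C → weight B′ (f m N B B′ C) ≡ weight B C
  weight-f {N} B B′ C lenB lenB′ lenC eq
    rewrite colengths≡colengthsFrom B lenB | colengths≡colengthsFrom B′ lenB′ = begin
    staircaseInv m 0 [] (inset (assemble B′ ws′ (inset C))) + sum (map cellsAbove (zip ds′ (offsets B′ (assemble B′ ws′ (inset C)))))
      ≡⟨ cong₂ (λ π os → staircaseInv m 0 [] π + sum (map cellsAbove (zip ds′ os)))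
           (inset-assemble B′ ws′ (inset C) len-ws′ fills) (offsets-assemble B′ ws′ (inset C) len-ws′) ⟩
    staircaseInv m 0 [] (inset C) + sum (map cellsAbove (zip ds′ ws′))
      ≡⟨ cong (staircaseInv m 0 [] (inset C) +_) same-cells ⟩
    staircaseInv m 0 [] (inset C) + sum (map cellsAbove ws) ∎
    where
    ds = colengthsFrom m 0 B
    ds′ = colengthsFrom m 0 B′
    ws = zip ds (offsets B C)
    ws′ = rearrange ds′ ws
    lenCB : length C ≡ length B
    lenCB = trans lenC (sym lenB)
    len-ws′ : length ws′ ≡ length B′
    len-ws′ = trans (length-rearrange ds′ ws) (length-colengthsFrom m 0 B′)
    rooks-ws : sum (map hasRook ws) ≡ #white C
    rooks-ws = trans (sum-hasRook ds (offsets B C) (trans (length-colengthsFrom m 0 B) (sym (length-offsets B C lenCB))))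
                     (#white-offsets B C lenCB)
    total : length (catMaybes ws′) + sum (map hasRook (unpaired ds′ ws)) ≡ #white C
    total = trans (cong (_+ sum (map hasRook (unpaired ds′ ws))) (sym (sum-hasRook ds′ ws′ (sym (length-rearrange ds′ ws)))))
                  (trans (sum-rearrange hasRook (λ _ → refl) ds′ ws) rooks-ws)
    -- The black rooks are the same on both sides, so a lost white rook would show in the total.
    enough : #white C ≤ length (catMaybes ws′)
    enough = +-cancelʳ-≤ (length (catMaybes (inset C))) _ _
      (≤-trans (≤-reflexive (trans (sym (#rooks-split C)) (sym eq))) (#rooks-assemble B′ ws′ (inset C)))
    all-kept : length (catMaybes ws′) ≡ #white C
    all-kept = ≤-antisym (≤-trans (m≤m+n _ _) (≤-reflexive total)) enough
    none-lost : sum (map hasRook (unpaired ds′ ws)) ≡ 0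
    none-lost = +-cancelˡ-≡ (length (catMaybes ws′)) _ _ (trans total (trans (sym all-kept) (sym (+-identityʳ _))))
    fills : length (catMaybes ws′) + length (inset C) ≡ length B′
    fills = trans (cong (_+ length (inset C)) all-kept) (trans (#white+inset C) (trans lenC (sym lenB′)))
    open ≡-Reasoning
    same-cells : sum (map cellsAbove (zip ds′ ws′)) ≡ sum (map cellsAbove ws)
    same-cells = begin
      sum (map cellsAbove (zip ds′ ws′))
        ≡⟨ +-identityʳ _ ⟨
      sum (map cellsAbove (zip ds′ ws′)) + 0
        ≡⟨ cong (sum (map cellsAbove (zip ds′ ws′)) +_)
             (cellsAbove-rookless (unpaired ds′ ws) none-lost) ⟨
      sum (map cellsAbove (zip ds′ ws′)) + sum (map cellsAbove (unpaired ds′ ws))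
        ≡⟨ sum-rearrange cellsAbove (λ _ → refl) ds′ ws ⟩
      sum (map cellsAbove ws)                                                       ∎

  open InS

  #rooks-InS : ∀ {N k B C} → InS m N k B C → #rooks C ≡ k
  #rooks-InS {C = C} inS = trans (#rooks-split C)
    (trans (cong (#white C +_) (proj₂ (proj₂ (blacks inS)))) (m+[n∸m]≡n (whiteCount inS)))

  length-InS : ∀ {N k B C} → length B ≡ N → InS m N k B C → length C ≡ N
  length-InS {N} {B = B} lenB inS = begin
    _                          ≡⟨ Pointwise-length (whites inS) ⟩
    length (zip B (Δ m N))     ≡⟨ length-zipWith _,_ B (Δ m N) ⟩
    _                          ≡⟨ m≤n⇒m⊓n≡m (≤-reflexive (trans lenB (sym (length-applyUpTo (_* m) N)))) ⟩
    length B                   ≡⟨ lenB ⟩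
    N                          ∎
    where open ≡-Reasoning

  weight-I-InS : ∀ {N k B C} → LevelClosed m B → InS m N k B C → weight B (I m B C) ≡ weight B C
  weight-I-InS {N} {k} {B} {C} closed inS = weight-I m B C closed (All.tabulate (λ _ → []))
    (subst (λ D → Pointwise WhiteBetween C (zip B D)) (Δ≡staircase m N) (whites inS))
    (subst (OnBoard (inset C)) (Δ≡staircase m (N ∸ #white C)) (proj₁ (blacks inS)))
    (proj₁ (proj₂ (blacks inS)))

  -- Membership in the target set fixes the number of rooks at `k`, which is what `weight-f` asks of
  -- an image under `f`.
  firstInS : ∀ {N k B B′ x z} → FirstInT′ m N k B B′ x z → InS m N k B′ x
  firstInS (here inT)          = proj₁ inT
  firstInS (there inS _ _ _ _) = inS

  weight-first : ∀ {N k B B′ x z} → LevelClosed m B → LevelClosed m B′ → length B ≡ N → length B′ ≡ N →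
                 FirstInT′ m N k B B′ x z → weight B′ x ≡ weight B′ z
  weight-first closed closed′ lenB lenB′ (here _) = refl
  weight-first {N} {k} {B} {B′} {x} {z} closed closed′ lenB lenB′ (there {u = u} x∈S′ _ u∈S fu≡I′x rest) = begin
    weight B′ x
      ≡⟨ weight-I-InS closed′ x∈S′ ⟨
    weight B′ (I m B′ x)
      ≡⟨ cong (weight B′) fu≡I′x ⟨
    weight B′ (f m N B B′ u)
      -- The image of `u` is `I m B′ x`, which has `k` rooks like `x`; so has `u`.
      ≡⟨ weight-f B B′ u lenB lenB′ lenu (trans (cong #rooks fu≡I′x)
           (trans (#rooks-I B′ x) (trans (#rooks-InS x∈S′) (sym (#rooks-InS u∈S))))) ⟩
    weight B u
      ≡⟨ weight-I-InS closed u∈S ⟨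
    weight B (I m B u)
      -- The image is the next element of the sequence, which `firstInS rest` places among the
      -- configurations with `k` rooks.
      ≡⟨ weight-f B B′ (I m B u) lenB lenB′ (trans (length-I B u) lenu)
           (trans (#rooks-InS (firstInS rest)) (sym (trans (#rooks-I B u) (#rooks-InS u∈S)))) ⟨
    weight B′ (f m N B B′ (I m B u))
      ≡⟨ weight-first closed closed′ lenB lenB′ rest ⟩
    weight B′ z ∎
    where
    open ≡-Reasoning
    lenu = length-InS lenB u∈S

  weight-T : ∀ {N B π} → LevelClosed m B → Pointwise _≤_ B (Δ m N) → OnBoard π B →
             weight B (map toEntry π) ≡ inv m B π + sum (colengthsFrom m 0 B)
  weight-T {N} {B} {π} closed fits on = begin
    staircaseInv m 0 [] (inset (map toEntry π)) + sum (map cellsAbove (zip (colengthsFrom m 0 B) (offsets B (map toEntry π))))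
      ≡⟨ cong₂ _+_ (cong (staircaseInv m 0 []) (inset-toEntry π))
           (cellsAbove-rookless (zip (colengthsFrom m 0 B) (offsets B (map toEntry π))) rookless) ⟩
    staircaseInv m 0 [] π + 0
      ≡⟨ +-identityʳ _ ⟩
    staircaseInv m 0 [] π
      ≡⟨ staircaseInv-onBoard m (subst (Pointwise _≤_ B) (Δ≡staircase m N) fits)
           closed (All.tabulate (λ _ → [])) on ⟩
    inv m B π + sum (colengthsFrom m 0 B) ∎
    where
    open ≡-Reasoning
    len : length (map toEntry π) ≡ length B
    len = trans (length-map toEntry π) (Pointwise-length on)
    rookless : sum (map hasRook (zip (colengthsFrom m 0 B) (offsets B (map toEntry π)))) ≡ 0
    rookless = trans (sum-hasRook (colengthsFrom m 0 B) (offsets B (map toEntry π))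
                       (trans (length-colengthsFrom m 0 B) (sym (length-offsets B _ len))))
                     (trans (#white-offsets B _ len) (#white-toEntry π))

  sum-colengths : ∀ {j B D} → Pointwise _≤_ B (staircase m j D) → sum (colengthsFrom m j B) + sum B ≡ sum (staircase m j D)
  sum-colengths {D = zero}  []           = refl
  sum-colengths {j} {b ∷ B} {suc D} (b≤ ∷ B≤) =
    trans (+-interchange (j * m ∸ b) (sum (colengthsFrom m (suc j) B)) b (sum B)) (cong₂ _+_ (m∸n+n≡m b≤) (sum-colengths B≤))

-- The area of a board as its first rook number.

module _ {A : Set} where

  length-filter-cong : ∀ {P Q : Pred A 0ℓ} (P? : Decidable P) (Q? : Decidable Q) {xs} → All (λ x → P x ⇔ Q x) xs →
                       length (filter P? xs) ≡ length (filter Q? xs)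
  length-filter-cong P? Q? []                  = refl
  length-filter-cong P? Q? {x ∷ xs} (e ∷ es) with P? x | Q? x
  ... | yes _ | yes _ = cong suc (length-filter-cong P? Q? es)
  ... | no  _ | no  _ = length-filter-cong P? Q? es
  ... | yes p | no ¬q = contradiction (to e p) ¬q
  ... | no ¬p | yes q = contradiction (from e q) ¬p

  length-filter-map : ∀ {B : Set} {P : Pred B 0ℓ} {Q : Pred A 0ℓ} (P? : Decidable P) (Q? : Decidable Q) (g : A → B) xs →
                      (∀ x → P (g x) ⇔ Q x) → length (filter P? (map g xs)) ≡ length (filter Q? xs)
  length-filter-map P? Q? g []       e = refl
  length-filter-map P? Q? g (x ∷ xs) e with P? (g x) | Q? x
  ... | yes _ | yes _ = cong suc (length-filter-map P? Q? g xs e)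
  ... | no  _ | no  _ = length-filter-map P? Q? g xs e
  ... | yes p | no ¬q = contradiction (to (e x) p) ¬q
  ... | no ¬p | yes q = contradiction (from (e x) q) ¬p

hasSize? : ∀ n → Decidable (λ (π : Rooks) → length (catMaybes π) ≡ n)
hasSize? n π = length (catMaybes π) ≟ n

#ofSize : ℕ → List Rooks → ℕ
#ofSize n L = length (filter (hasSize? n) L)

#ofSize-++ : ∀ n L L′ → #ofSize n (L ++ L′) ≡ #ofSize n L + #ofSize n L′
#ofSize-++ n L L′ = trans (cong length (filter-++ (hasSize? n) L L′)) (length-++ (filter (hasSize? n) L))

#ofSize-nothing : ∀ n L → #ofSize n (map (nothing ∷_) L) ≡ #ofSize n L
#ofSize-nothing n L = length-filter-map (hasSize? n) (hasSize? n) (nothing ∷_) L (λ _ → mk⇔ (λ e → e) (λ e → e))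

#ofSize-0-just : ∀ (rs : List ℕ) L → #ofSize 0 (cartesianProductWith _∷_ (map just rs) L) ≡ 0
#ofSize-0-just []       L = refl
#ofSize-0-just (r ∷ rs) L = trans (#ofSize-++ 0 (map (just r ∷_) L) _) (cong₂ _+_ (none L) (#ofSize-0-just rs L))
  where
  none : ∀ L → #ofSize 0 (map (just r ∷_) L) ≡ 0
  none []      = refl
  none (π ∷ L) = none L

#ofSize-1-just : ∀ (rs : List ℕ) L → #ofSize 1 (cartesianProductWith _∷_ (map just rs) L) ≡ length rs * #ofSize 0 L
#ofSize-1-just []       L = refl
#ofSize-1-just (r ∷ rs) L = trans (#ofSize-++ 1 (map (just r ∷_) L) _)
  (cong₂ _+_ (length-filter-map (hasSize? 1) (hasSize? 0) (just r ∷_) L (λ _ → mk⇔ suc-injective (cong suc)))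
             (#ofSize-1-just rs L))

#ofSize-0-allRooks : ∀ B → #ofSize 0 (allRooks B) ≡ 1
#ofSize-0-allRooks []      = refl
#ofSize-0-allRooks (h ∷ B) = trans (#ofSize-++ 0 (map (nothing ∷_) (allRooks B)) _)
  (cong₂ _+_ (trans (#ofSize-nothing 0 (allRooks B)) (#ofSize-0-allRooks B)) (#ofSize-0-just (upTo h) (allRooks B)))

-- Either the first column is empty and the rook stands further right, or it stands in one of `h`
-- rows and the remaining columns are empty in the only possible way.
#ofSize-1-allRooks : ∀ B → #ofSize 1 (allRooks B) ≡ sum B
#ofSize-1-allRooks []      = refl
#ofSize-1-allRooks (h ∷ B) = begin
  #ofSize 1 (allRooks (h ∷ B))
    ≡⟨ #ofSize-++ 1 (map (nothing ∷_) (allRooks B)) _ ⟩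
  #ofSize 1 (map (nothing ∷_) (allRooks B)) + _
    ≡⟨ cong₂ _+_ (trans (#ofSize-nothing 1 (allRooks B)) (#ofSize-1-allRooks B))
                 (#ofSize-1-just (upTo h) (allRooks B)) ⟩
  sum B + length (upTo h) * #ofSize 0 (allRooks B)
    ≡⟨ cong₂ (λ x y → sum B + x * y) (length-upTo h) (#ofSize-0-allRooks B) ⟩
  sum B + h * 1
    ≡⟨ cong (sum B +_) (*-identityʳ h) ⟩
  sum B + h
    ≡⟨ +-comm (sum B) h ⟩
  h + sum B ∎
  where open ≡-Reasoning

allRooks-onBoard : ∀ B → All (λ π → OnBoard π B) (allRooks B)
allRooks-onBoard []      = [] ∷ []
allRooks-onBoard (h ∷ B) = All.cartesianProductWith⁺ (setoid _) (setoid _) _∷_ (nothing ∷ map just (upTo h)) (allRooks B)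
  (λ x∈ π∈ → All.lookup column x∈ ∷ All.lookup (allRooks-onBoard B) π∈)
  where
  column : All (MaybeAll (_< h)) (nothing ∷ map just (upTo h))
  column = nothing ∷ All.map⁺ (All.map just (All.all-upTo h))

-- A single rook cannot repeat a level, so only the size has to be checked among the rook sets
-- listed for `B`.
rookNumber-1 : ∀ m .{{_ : NonZero m}} B → rookNumber m 1 B ≡ sum B
rookNumber-1 m B = trans
  (length-filter-cong (isPlacement? m 1 B) (hasSize? 1)
    (All.map (λ on → mk⇔ (λ (_ , _ , size) → size) (λ size → on , unique size , size)) (allRooks-onBoard B)))
  (#ofSize-1-allRooks B)
  where
  unique : ∀ {rs : List ℕ} → length rs ≡ 1 → Unique (map (_/ m) rs)
  unique {r ∷ []} _ = [] ∷ []

sum-pad : ∀ N B → sum (pad N B) ≡ sum B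
sum-pad N B = trans (sum-++ (replicate (N ∸ length B) 0) B) (cong (_+ sum B) (zeros (N ∸ length B)))
  where
  zeros : ∀ n → sum (replicate n 0) ≡ 0
  zeros zero    = refl
  zeros (suc n) = zeros n

theorem23 : (m : ℕ) .{{_ : NonZero m}} (B B′ : Board) →
    SingletonBoard m B → SingletonBoard m B′ → RookEquivalent m B B′ →
    (N : ℕ) → Fits m N B → Fits m N B′ → (k : ℕ) → k < N →
    (g : Placement m k (pad N B) → Placement m k (pad N B′)) →
    IsGarsiaMilne m N k (pad N B) (pad N B′) g →
    (π : Placement m k (pad N B)) →
    inv m (pad N B) (proj₁ π) ≡ inv m (pad N B′) (proj₁ (g π))
theorem23 m B B′ single single′ equiv N fits fits′ k _ g isGM t@(π , on , _ , size) =
  -- The cancelled term is the number of cells of `Δ` outside the board, the same for both boards by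
  -- `same-area`.
  +-cancelʳ-≡ (sum (colengthsFrom m 0 P)) _ _ (begin
    inv m P π + sum (colengthsFrom m 0 P)    ≡⟨ weight-T m closed fits on ⟨
    -- The first element of the sequence has `k` rooks by `firstInS`, as many as `π`.
    weight m P (map toEntry π)               ≡⟨ weight-f m P P′ (map toEntry π) lenP lenP′ lenπ
                                                  (trans (#rooks-InS m (firstInS m (isGM t))) (sym #rooks-π)) ⟨
    weight m P′ (f m N P P′ (map toEntry π)) ≡⟨ weight-first m closed closed′ lenP lenP′ (isGM t) ⟩
    weight m P′ (map toEntry ρ)              ≡⟨ weight-T m closed′ fits′ (proj₁ (proj₂ (g t))) ⟩
    inv m P′ ρ + sum (colengthsFrom m 0 P′)  ≡⟨ cong (inv m P′ ρ +_) same-area ⟨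
    inv m P′ ρ + sum (colengthsFrom m 0 P)   ∎)
  where
  open ≡-Reasoning
  P = pad N B
  P′ = pad N B′
  ρ = proj₁ (g t)
  closed = levelClosed-pad m (N ∸ length B) (singleton⇒levelClosed m single)
  closed′ = levelClosed-pad m (N ∸ length B′) (singleton⇒levelClosed m single′)
  lenP : length P ≡ N
  lenP = trans (Pointwise-length fits) (length-applyUpTo (_* m) N)
  lenP′ : length P′ ≡ N
  lenP′ = trans (Pointwise-length fits′) (length-applyUpTo (_* m) N)
  lenπ : length (map toEntry π) ≡ N
  lenπ = trans (length-map toEntry π) (trans (Pointwise-length on) lenP)
  #rooks-π : #rooks (map toEntry π) ≡ k
  #rooks-π = trans (#rooks-split (map toEntry π))
    (trans (cong₂ _+_ (#white-toEntry π) (cong (length ∘ catMaybes) (inset-toEntry π))) size)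
  sum-P : sum P ≡ sum P′
  sum-P = begin
    sum P             ≡⟨ sum-pad N B ⟩
    sum B             ≡⟨ rookNumber-1 m B ⟨
    rookNumber m 1 B  ≡⟨ equiv 1 ⟩
    rookNumber m 1 B′ ≡⟨ rookNumber-1 m B′ ⟩
    sum B′            ≡⟨ sum-pad N B′ ⟨
    sum P′            ∎
  same-area : sum (colengthsFrom m 0 P) ≡ sum (colengthsFrom m 0 P′)
  -- For either board, the cells inside and outside together make up `Δ`.
  same-area = +-cancelʳ-≡ (sum P) _ _ (begin
    sum (colengthsFrom m 0 P) + sum P    ≡⟨ sum-colengths m (subst (Pointwise _≤_ P) (Δ≡staircase m N) fits) ⟩
    sum (staircase m 0 N)                ≡⟨ sum-colengths m (subst (Pointwise _≤_ P′) (Δ≡staircase m N) fits′) ⟨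
    sum (colengthsFrom m 0 P′) + sum P′  ≡⟨ cong (sum (colengthsFrom m 0 P′) +_) sum-P ⟨
    sum (colengthsFrom m 0 P′) + sum P   ∎)
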